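{- Let $n\ge 2$. The number of narcissistic preference profiles $(\succ_1,\succ_2,\dots,\succ_n)$ for the voter set $\mathcal{V}=\{1,2,\dots,n\}$ that are single-crossing with respect to the linear order $1\triangleright 2\triangleright\cdots\triangleright n$ is $2^{\binom{n-1}{2}}$.
   Context: Let $\mathcal{V}=\{1,2,\dots,n\}$ be a set of voters, which is also the set of alternatives. A preference order $\succ$ on $\mathcal{V}$ is a strict linear order on $\mathcal{V}$; $a\succ b$ means $a$ is preferred to $b$. A preference profile for $\mathcal{V}$ is an $n$-tuple $(\succ_1,\dots,\succ_n)$ of preference orders on $\mathcal{V}$, where $\succ_i$ is the preference order of voter $i$. A profile is narcissistic if for every voter $i\in\mathcal{V}$ the most preferred alternative in $\succ_i$ is $i$ itself. Given a (strict) linear order $\triangleright$ on $\mathcal{V}$, a profile is single-crossing with respect to $\triangleright$ if for every two distinct alternatives $a,b\in\mathcal{V}$ and every three voters $i,j,k\in\mathcal{V}$ with $i\triangleright j\triangleright k$: if $a\succ_i b$ and $a\succ_k b$, then $a\succ_j b$. Profiles are counted as $n$-tuples (distinct tuples are distinct profiles). The convention $\binom{1}{2}=0$ is used. -}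

module Defs where

open import Level using (0ℓ; _⊔_)
open import Data.Nat.Base using (ℕ)
open import Data.Fin.Base using (Fin; _<_)
open import Data.Fin.Properties using (<-isStrictTotalOrder)
open import Data.Product.Base using (Σ-syntax; _×_; _,_; proj₁)
open import Data.Vec.Functional using (Vector)
import Data.Vec.Functional.Relation.Binary.Equality.Setoid as VecEq
open import Function.Base using (id; _∘_)
open import Function.Bundles using (Inverse)
open import Relation.Binary.Bundles using (Setoid)
open import Relation.Binary.Core using (Rel; _⇔_)
open import Relation.Binary.Structures using (IsStrictTotalOrder)
import Relation.Binary.Construct.On as On
open import Relation.Binary.PropositionalEquality.Core using (_≡_; _≢_)
import Relation.Binary.PropositionalEquality.Properties as ≡

-- The set {1, …, n} is represented by Fin n, with k + 1 in the role of k.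

record StrictLinearOrder (n : ℕ) : Set₁ where
  field
    _≻_                : Rel (Fin n) 0ℓ
    isStrictTotalOrder : IsStrictTotalOrder _≡_ _≻_

-- Two orders are the same when they relate the same pairs; neither the
-- types used to express the relation nor the proofs of the order axioms
-- distinguish them.

strictLinearOrderSetoid : ℕ → Setoid _ _
strictLinearOrderSetoid n = record
  { Carrier       = StrictLinearOrder n
  ; _≈_           = λ P Q → _≻_ P ⇔ _≻_ Q
  ; isEquivalence = record
    { refl  = id , id
    ; sym   = λ (f , g) → g , f
    ; trans = λ (f , g) (h , k) → h ∘ f , g ∘ k
    }
  }
  where open StrictLinearOrder

-- i ▷ j in the order 1 ▷ 2 ▷ ⋯ ▷ n means that i is numerically smaller.

naturalOrder : ∀ n → StrictLinearOrder n
naturalOrder n = record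
  { _≻_                = _<_
  ; isStrictTotalOrder = <-isStrictTotalOrder
  }

Profile : ℕ → Set₁
Profile n = Vector (StrictLinearOrder n) n

profileSetoid : ℕ → Setoid _ _
profileSetoid n = VecEq.≋-setoid (strictLinearOrderSetoid n) n

module _ {n : ℕ} where

  -- a ≻[ P , i ] b is a ≻ᵢ b for the profile P = (≻₁, …, ≻ₙ).

  Prefers : Profile n → Fin n → Rel (Fin n) 0ℓ
  Prefers P i = StrictLinearOrder._≻_ (P i)

  syntax Prefers P i a b = a ≻[ P , i ] b

  Narcissistic : Profile n → Set
  Narcissistic P = ∀ i a → a ≢ i → i ≻[ P , i ] a

  SingleCrossing : StrictLinearOrder n → Profile n → Set
  SingleCrossing ▷-order P =
    ∀ a b → a ≢ b → ∀ i j k → i ▷ j → j ▷ k →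
    a ≻[ P , i ] b → a ≻[ P , k ] b → a ≻[ P , j ] b
    where open StrictLinearOrder ▷-order renaming (_≻_ to _▷_)

narcissisticSingleCrossingProfiles : ∀ n → StrictLinearOrder n → Setoid _ _
narcissisticSingleCrossingProfiles n ▷-order =
  On.setoid {B = Σ[ P ∈ Profile n ] (Narcissistic P × SingleCrossing ▷-order P)}
            (profileSetoid n) proj₁

-- Cardinality is counted up to the equality of the setoid.

HasCardinality : ∀ {a ℓ} → Setoid a ℓ → ℕ → Set (a ⊔ ℓ)
HasCardinality S m = Inverse S (≡.setoid (Fin m))

module Submission where

-- For a < b the voters preferring a to b form an initial segment of 1, …, n: voter a prefers
-- a, voter b prefers b, and each preference switches only once.  Let t a b be its length.
-- Transitivity of the preferences says exactly that t is monotone in a and in b, so the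
-- diagonals b − a = 1, 2, … form a Gelfand–Tsetlin pattern whose longest row is 1, …, n − 1.
-- The number of such patterns is 2 ^ C(n − 1, 2): the row below 1, …, m is 1, …, m − 1 with an
-- arbitrary subset of its entries raised by one, and by the dual Pieri rule these rows carry
-- together 2 ^ (m − 1) times as many patterns as 1, …, m − 1 itself.

open import Defs
open import Data.Empty using (⊥-elim)
open import Data.Fin.Base as Fin using (Fin; zero; suc; toℕ)
open import Data.Fin.Properties as Fin using (*↔×; 1↔⊤; toℕ-injective; toℕ-fromℕ<; toℕ<n)
open import Data.Nat.Base
open import Data.Nat.Combinatorics using (_C_; nCk+nC[k+1]≡[n+1]C[k+1]; nC1≡n)
open import Data.Nat.DivMod using (_mod_; m<n⇒m%n≡m)
open import Data.Nat.Properties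
open import Data.Product.Algebra using (×-assoc)
open import Data.Product.Base using (Σ; Σ-syntax; _×_; _,_; proj₁; proj₂)
open import Data.Product.Function.Dependent.Propositional using () renaming (congˡ to Σ-congˡ)
open import Data.Product.Function.NonDependent.Propositional using (_×-↔_)
open import Data.Sum.Base using (_⊎_; inj₁; inj₂)
open import Data.Unit.Base using (⊤; tt)
open import Data.Vec.Base using (Vec; []; _∷_; head)
open import Function.Base using (_∘_)
open import Function.Bundles using (_↔_; mk↔ₛ′; _⇔_; mk⇔; Inverse; Equivalence)
import Function.Construct.Composition as Composition
open import Function.Properties.Inverse using (↔-refl; ↔-sym; ↔-trans)
open import Function.Related.Propositional using (module EquationalReasoning; bijection; ≡⇒)
open import Level using (0ℓ)
open import Relation.Binary.Bundles using (Setoid)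
open import Relation.Binary.Definitions using (Trichotomous; tri<; tri≈; tri>)
open import Relation.Binary.PropositionalEquality
open import Relation.Binary.Structures using (IsStrictTotalOrder)
open import Relation.Binary.Structures.Biased using (isStrictTotalOrderᶜ)
open import Relation.Nullary using (¬_; Irrelevant; yes; no)
open import Relation.Unary using (Pred; Decidable)

private
  variable
    k l n : ℕ
    P Q : Pred (Fin n) 0ℓ

-- Elementary bijections.

Σ-cong : {A : Set} {B C : A → Set} → (∀ x → B x ↔ C x) → Σ A B ↔ Σ A C
Σ-cong B↔C = Σ-congˡ {k = bijection} (λ {x} → B↔C x)

empty↔ : {A B : Set} → ¬ A → ¬ B → A ↔ B
empty↔ ¬a ¬b = mk↔ₛ′ (⊥-elim ∘ ¬a) (⊥-elim ∘ ¬b) (⊥-elim ∘ ¬b) (⊥-elim ∘ ¬a)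

⊤-× : {A : Set} → (⊤ × A) ↔ A
⊤-× = mk↔ₛ′ proj₂ (tt ,_) (λ _ → refl) (λ _ → refl)

×-swap₃ : {A B C : Set} → (A × B × C) ↔ (B × A × C)
×-swap₃ = mk↔ₛ′ (λ (a , b , c) → b , a , c) (λ (b , a , c) → a , b , c) (λ _ → refl) (λ _ → refl)

×-irrelevant : {A B : Set} → Irrelevant A → Irrelevant B → Irrelevant (A × B)
×-irrelevant irrA irrB (a , b) (a′ , b′) = cong₂ _,_ (irrA a a′) (irrB b b′)

module _ {P : ℕ → Set} (irr : ∀ {z} → Irrelevant (P z)) where

  Σ-≡ : {p q : Σ ℕ P} → proj₁ p ≡ proj₁ q → p ≡ q
  Σ-≡ refl = cong (_ ,_) (irr _ _)

  singleton↔ : ∀ {x} → P x → (∀ {z} → P z → z ≡ x) → Σ ℕ P ↔ ⊤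
  singleton↔ {x} px unique =
    mk↔ₛ′ _ (λ _ → x , px) (λ _ → refl) (λ (_ , pz) → Σ-≡ (sym (unique pz)))

  pair↔ : ∀ {x} → P x → P (suc x) → (∀ {z} → P z → x ≤ z × z ≤ suc x) → Σ ℕ P ↔ Fin 2
  pair↔ {x} px px′ bounds = mk↔ₛ′ to from to∘from from∘to
    where
    to : Σ ℕ P → Fin 2
    to (z , _) with z ≟ x
    ... | yes _ = zero
    ... | no  _ = suc zero

    from : Fin 2 → Σ ℕ P
    from zero       = x , px
    from (suc zero) = suc x , px′

    to∘from : ∀ b → to (from b) ≡ b
    to∘from zero       with x ≟ x
    ... | yes _   = refl
    ... | no  x≢x = ⊥-elim (x≢x refl)
    to∘from (suc zero) with suc x ≟ x
    ... | yes eq = ⊥-elim (1+n≢n eq)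
    ... | no  _  = refl

    from∘to : ∀ p → from (to p) ≡ p
    from∘to (z , pz) with z ≟ x
    ... | yes z≡x = Σ-≡ (sym z≡x)
    ... | no  z≢x =
      Σ-≡ (≤-antisym (≤∧≢⇒< (proj₁ (bounds pz)) (≢-sym z≢x)) (proj₂ (bounds pz)))

-- Interlacing rows, vertical strips and their exchange.

infix 4 _≺_ _↗_

_≺_ : Vec ℕ k → Vec ℕ (suc k) → Set
[]       ≺ _        = ⊤
(y ∷ ys) ≺ (x ∷ xs) = x ≤ y × y ≤ head xs × ys ≺ xs

-- With rows read as partitions listed from the smallest part, `xs ↗ zs` says that `zs` adds a
-- vertical strip to `xs`: at most one box in each part.
_↗_ : Vec ℕ k → Vec ℕ k → Set
[]       ↗ []       = ⊤
(x ∷ xs) ↗ (z ∷ zs) = (x ≤ z × z ≤ suc x) × xs ↗ zs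

Ascending : ℕ → Vec ℕ k → Set
Ascending l []       = ⊤
Ascending l (x ∷ xs) = l ≤ x × Ascending x xs

≺-irrelevant : ∀ (ys : Vec ℕ k) xs → Irrelevant (ys ≺ xs)
≺-irrelevant []       _        = λ _ _ → refl
≺-irrelevant (y ∷ ys) (x ∷ xs) =
  ×-irrelevant ≤-irrelevant (×-irrelevant ≤-irrelevant (≺-irrelevant ys xs))

↗-irrelevant : ∀ (xs zs : Vec ℕ k) → Irrelevant (xs ↗ zs)
↗-irrelevant []       []       = λ _ _ → refl
↗-irrelevant (x ∷ xs) (z ∷ zs) =
  ×-irrelevant (×-irrelevant ≤-irrelevant ≤-irrelevant) (↗-irrelevant xs zs)

≺⇒ascendingˡ : ∀ {ys : Vec ℕ k} {x xs} → l ≤ x → ys ≺ (x ∷ xs) → Ascending l ys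
≺⇒ascendingˡ {ys = []}     l≤x _ = tt
≺⇒ascendingˡ {ys = y ∷ ys} {xs = x′ ∷ xs} l≤x (x≤y , y≤x′ , ys≺xs) =
  ≤-trans l≤x x≤y , ≺⇒ascendingˡ y≤x′ ys≺xs

≺⇒ascendingʳ : ∀ {ys : Vec ℕ k} {x xs} → l ≤ x → ys ≺ (x ∷ xs) → Ascending l (x ∷ xs)
≺⇒ascendingʳ {ys = []} {xs = []}     l≤x _ = l≤x , tt
≺⇒ascendingʳ {ys = y ∷ ys} {xs = x′ ∷ xs} l≤x (x≤y , y≤x′ , ys≺xs) =
  l≤x , ≺⇒ascendingʳ (≤-trans x≤y y≤x′) ys≺xs

-- The two ways round a square with corners `xs` and `ys`: over a row raised from `xs`, or under a
-- row from which `ys` is raised. Comparing their numbers is the local step of the Pieri rule.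
Above Below : Vec ℕ (suc k) → Vec ℕ k → Set
Above {k} xs ys = Σ[ zs ∈ Vec ℕ (suc k) ] (xs ↗ zs × ys ≺ zs)
Below {k} xs ys = Σ[ zs ∈ Vec ℕ k ] (zs ↗ ys × zs ≺ xs)

-- The lower bound l is the entry of ys to the left of the head of the new row.

Above≥ : ℕ → Vec ℕ (suc k) → Vec ℕ k → Set
Above≥ {k} l xs ys = Σ[ zs ∈ Vec ℕ (suc k) ] (l ≤ head zs × xs ↗ zs × ys ≺ zs)

AboveEntry BelowEntry : ℕ → ℕ → ℕ → ℕ → Set
AboveEntry l x y z = l ≤ z × (x ≤ z × z ≤ suc x) × z ≤ y
BelowEntry x y x′ z = (z ≤ y × y ≤ suc z) × x ≤ z × z ≤ x′

AboveEntry-irrelevant : ∀ {l x y z} → Irrelevant (AboveEntry l x y z)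
AboveEntry-irrelevant =
  ×-irrelevant ≤-irrelevant (×-irrelevant (×-irrelevant ≤-irrelevant ≤-irrelevant) ≤-irrelevant)

BelowEntry-irrelevant : ∀ {x y x′ z} → Irrelevant (BelowEntry x y x′ z)
BelowEntry-irrelevant =
  ×-irrelevant (×-irrelevant ≤-irrelevant ≤-irrelevant) (×-irrelevant ≤-irrelevant ≤-irrelevant)

Above≥-[] : ∀ {x} → Above≥ l (x ∷ []) [] ↔ (Σ[ z ∈ ℕ ] (l ≤ z × x ≤ z × z ≤ suc x))
Above≥-[] = mk↔ₛ′
  (λ { (z ∷ [] , l≤z , (x≤z , tt) , tt) → z , l≤z , x≤z })
  (λ { (z , l≤z , x≤z) → z ∷ [] , l≤z , (x≤z , tt) , tt })
  (λ _ → refl)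
  (λ { (_ ∷ [] , _) → refl })

Below-[] : ∀ {x} → Below (x ∷ []) [] ↔ ⊤
Below-[] = mk↔ₛ′ _ (λ _ → [] , tt , tt) (λ _ → refl) (λ { ([] , _) → refl })

module _ {k x x′ y : ℕ} {xs ys : Vec ℕ k} where

  -- Neighbouring entries of the new row are separated by an entry of `ys` here, and by an entry of
  -- the upper row in `Below-∷`, so they are chosen independently and the type factors.
  Above≥-∷ : Above≥ l (x ∷ x′ ∷ xs) (y ∷ ys) ↔ (Σ ℕ (AboveEntry l x y) × Above≥ y (x′ ∷ xs) ys)
  Above≥-∷ = mk↔ₛ′
    (λ { (z ∷ zs , l≤z , (x≤z , xs↗zs) , z≤y , y≤zs , ys≺zs) →
         (z , l≤z , x≤z , z≤y) , (zs , y≤zs , xs↗zs , ys≺zs) })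
    (λ { ((z , l≤z , x≤z , z≤y) , (zs , y≤zs , xs↗zs , ys≺zs)) →
         z ∷ zs , l≤z , (x≤z , xs↗zs) , z≤y , y≤zs , ys≺zs })
    (λ _ → refl)
    (λ { (_ ∷ _ , _) → refl })

  Below-∷ : Below (x ∷ x′ ∷ xs) (y ∷ ys) ↔ (Σ ℕ (BelowEntry x y x′) × Below (x′ ∷ xs) ys)
  Below-∷ = mk↔ₛ′
    (λ { (z ∷ zs , (z≤y , zs↗ys) , x≤z , z≤x′ , zs≺xs) →
         (z , z≤y , x≤z , z≤x′) , (zs , zs↗ys , zs≺xs) })
    (λ { ((z , z≤y , x≤z , z≤x′) , (zs , zs↗ys , zs≺xs)) →
         z ∷ zs , (z≤y , zs↗ys) , x≤z , z≤x′ , zs≺xs })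
    (λ _ → refl)
    (λ { (_ ∷ _ , _) → refl })

open EquationalReasoning

module _ {l x y : ℕ} where

  AboveEntry-stuck : l ≤ x → y ≡ x → Σ ℕ (AboveEntry l x y) ↔ ⊤
  AboveEntry-stuck l≤x refl = singleton↔ AboveEntry-irrelevant
    (l≤x , (≤-refl , n≤1+n _) , ≤-refl)
    (λ (_ , (x≤z , _) , z≤x) → ≤-antisym z≤x x≤z)

  AboveEntry-free : l ≤ x → x < y → Σ ℕ (AboveEntry l x y) ↔ Fin 2
  AboveEntry-free l≤x x<y = pair↔ AboveEntry-irrelevant
    (l≤x , (≤-refl , n≤1+n _) , <⇒≤ x<y)
    (m≤n⇒m≤1+n l≤x , (n≤1+n _ , ≤-refl) , x<y)
    (λ (_ , bounds , _) → bounds)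

  AboveEntry-raised : l ≡ suc x → x < y → Σ ℕ (AboveEntry l x y) ↔ ⊤
  AboveEntry-raised refl x<y = singleton↔ AboveEntry-irrelevant
    (≤-refl , (n≤1+n _ , ≤-refl) , x<y)
    (λ (x<z , (_ , z≤1+x) , _) → ≤-antisym z≤1+x x<z)

module _ {x y x′ : ℕ} where

  BelowEntry-stuck : x ≤ x′ → y ≡ x → Σ ℕ (BelowEntry x y x′) ↔ ⊤
  BelowEntry-stuck x≤x′ refl = singleton↔ BelowEntry-irrelevant
    ((≤-refl , n≤1+n _) , ≤-refl , x≤x′)
    (λ ((z≤x , _) , x≤z , _) → ≤-antisym z≤x x≤z)

  BelowEntry-free : x < y → y ≤ x′ → Σ ℕ (BelowEntry x y x′) ↔ Fin 2
  -- The match turns the upper candidate into a successor, so that it and its predecessor are the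
  -- two consecutive values that `pair↔` expects.
  BelowEntry-free (s≤s x≤y) y<x′ = pair↔ BelowEntry-irrelevant
    ((n≤1+n _ , ≤-refl) , x≤y , <⇒≤ y<x′)
    ((≤-refl , n≤1+n _) , m≤n⇒m≤1+n x≤y , y<x′)
    (λ ((z≤y , y≤1+z) , _) → s≤s⁻¹ y≤1+z , z≤y)

  BelowEntry-lowered : x ≤ x′ → y ≡ suc x′ → Σ ℕ (BelowEntry x y x′) ↔ ⊤
  BelowEntry-lowered x≤x′ refl = singleton↔ BelowEntry-irrelevant
    ((n≤1+n _ , ≤-refl) , x≤x′ , ≤-refl)
    (λ ((_ , 1+x′≤1+z) , _ , z≤x′) → ≤-antisym z≤x′ (s≤s⁻¹ 1+x′≤1+z))

module _ {k x x′ y : ℕ} {xs ys : Vec ℕ k} where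

  Above≥-∷-empty : y < x ⊎ suc x′ < y → ¬ Above≥ l (x ∷ x′ ∷ xs) (y ∷ ys)
  Above≥-∷-empty (inj₁ y<x) (_ ∷ _ , _ , ((x≤z , _) , _) , z≤y , _) = <⇒≱ y<x (≤-trans x≤z z≤y)
  Above≥-∷-empty (inj₂ 1+x′<y) (_ ∷ _ ∷ _ , _ , (_ , (_ , z′≤1+x′) , _) , _ , y≤z′ , _) =
    <⇒≱ 1+x′<y (≤-trans y≤z′ z′≤1+x′)

  Below-∷-empty : y < x ⊎ suc x′ < y → ¬ Below (x ∷ x′ ∷ xs) (y ∷ ys)
  Below-∷-empty (inj₁ y<x) (_ ∷ _ , ((z≤y , _) , _) , x≤z , _) = <⇒≱ y<x (≤-trans x≤z z≤y)
  Below-∷-empty (inj₂ 1+x′<y) (_ ∷ _ , ((_ , y≤1+z) , _) , _ , z≤x′ , _) =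
    <⇒≱ 1+x′<y (≤-trans y≤1+z (s≤s z≤x′))

-- Reading the rows from left to right, the new entry z over x (with z = x or x + 1) and the new
-- entry under y (y or y − 1) lose their freedom at the same places: y = x fixes the entry over x
-- and the one under y, and y = x′ + 1 fixes the one under y and forces the next entry over x′
-- up.  Since Above has one entry more, it has one free bit more, unless that bit has already
-- been spent on raising the first entry (Above≥↔Below).

mutual
  Above≥↔2×Below : ∀ x (xs ys : Vec ℕ k) → l ≤ x → Ascending x xs → Ascending l ys →
                   Above≥ l (x ∷ xs) ys ↔ (Fin 2 × Below (x ∷ xs) ys)
  Above≥↔2×Below {l = l} x [] [] l≤x _ _ =
    Above≥ l (x ∷ []) []
      ↔⟨ Above≥-[] ⟩
    (Σ[ z ∈ ℕ ] (l ≤ z × x ≤ z × z ≤ suc x))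
      ↔⟨ pair↔ (×-irrelevant ≤-irrelevant (×-irrelevant ≤-irrelevant ≤-irrelevant))
               (l≤x , ≤-refl , n≤1+n _) (m≤n⇒m≤1+n l≤x , n≤1+n _ , ≤-refl) proj₂ ⟩
    Fin 2
      ↔⟨ mk↔ₛ′ (_, tt) proj₁ (λ _ → refl) (λ _ → refl) ⟩
    (Fin 2 × ⊤)
      ↔⟨ ↔-refl ×-↔ ↔-sym Below-[] ⟩
    (Fin 2 × Below (x ∷ []) []) ∎
  Above≥↔2×Below {l = l} x (x′ ∷ xs) (y ∷ ys) l≤x (x≤x′ , asc-xs) (l≤y , asc-ys) with <-cmp x y
  ... | tri> _ _ y<x =
    empty↔ (Above≥-∷-empty (inj₁ y<x)) (Below-∷-empty (inj₁ y<x) ∘ proj₂)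
  ... | tri≈ _ x≡y _ =
    Above≥ l (x ∷ x′ ∷ xs) (y ∷ ys)
      ↔⟨ Above≥-∷ ⟩
    (Σ ℕ (AboveEntry l x y) × Above≥ y (x′ ∷ xs) ys)
      ↔⟨ ↔-trans (AboveEntry-stuck l≤x (sym x≡y)) (↔-sym (BelowEntry-stuck x≤x′ (sym x≡y)))
         ×-↔ Above≥↔2×Below x′ xs ys (subst (_≤ x′) x≡y x≤x′) asc-xs asc-ys ⟩
    (Σ ℕ (BelowEntry x y x′) × Fin 2 × Below (x′ ∷ xs) ys)
      ↔⟨ ×-swap₃ ⟩
    (Fin 2 × Σ ℕ (BelowEntry x y x′) × Below (x′ ∷ xs) ys)
      ↔⟨ ↔-refl ×-↔ ↔-sym Below-∷ ⟩
    (Fin 2 × Below (x ∷ x′ ∷ xs) (y ∷ ys)) ∎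
  ... | tri< x<y _ _ =
    Above≥ l (x ∷ x′ ∷ xs) (y ∷ ys)
      ↔⟨ Above≥-∷ ⟩
    (Σ ℕ (AboveEntry l x y) × Above≥ y (x′ ∷ xs) ys)
      ↔⟨ AboveEntry-free l≤x x<y ×-↔ Above≥↔Below∷ x≤x′ x<y asc-xs asc-ys ⟩
    (Fin 2 × Below (x ∷ x′ ∷ xs) (y ∷ ys)) ∎

  Above≥↔Below : ∀ x (xs ys : Vec ℕ k) → Ascending x xs → Ascending (suc x) ys →
                 Above≥ (suc x) (x ∷ xs) ys ↔ Below (x ∷ xs) ys
  Above≥↔Below x [] [] _ _ =
    Above≥ (suc x) (x ∷ []) []
      ↔⟨ Above≥-[] ⟩
    (Σ[ z ∈ ℕ ] (suc x ≤ z × x ≤ z × z ≤ suc x))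
      ↔⟨ singleton↔ (×-irrelevant ≤-irrelevant (×-irrelevant ≤-irrelevant ≤-irrelevant))
                    (≤-refl , n≤1+n _ , ≤-refl)
                    (λ (x<z , _ , z≤1+x) → ≤-antisym z≤1+x x<z) ⟩
    ⊤
      ↔⟨ ↔-sym Below-[] ⟩
    Below (x ∷ []) [] ∎
  Above≥↔Below x (x′ ∷ xs) (y ∷ ys) (x≤x′ , asc-xs) (x<y , asc-ys) =
    Above≥ (suc x) (x ∷ x′ ∷ xs) (y ∷ ys)
      ↔⟨ Above≥-∷ ⟩
    (Σ ℕ (AboveEntry (suc x) x y) × Above≥ y (x′ ∷ xs) ys)
      ↔⟨ AboveEntry-raised refl x<y ×-↔ Above≥↔Below∷ x≤x′ x<y asc-xs asc-ys ⟩
    (⊤ × Below (x ∷ x′ ∷ xs) (y ∷ ys))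
      ↔⟨ ⊤-× ⟩
    Below (x ∷ x′ ∷ xs) (y ∷ ys) ∎

  -- What is left once the entry over `x` has been split off. The right side still holds the entry
  -- under `y`. If `y ≤ x′`, it has two values and matches the bit of `Above≥↔2×Below`. If
  -- `y ≡ suc x′`, it has one, and the lower bound `y` raises the entry over `x′`.
  Above≥↔Below∷ : ∀ {x x′ y} {xs ys : Vec ℕ k} →
                  x ≤ x′ → x < y → Ascending x′ xs → Ascending y ys →
                  Above≥ y (x′ ∷ xs) ys ↔ Below (x ∷ x′ ∷ xs) (y ∷ ys)
  Above≥↔Below∷ {x = x} {x′} {y} {xs} {ys} x≤x′ x<y asc-xs asc-ys with <-cmp y (suc x′)
  ... | tri< y≤x′ _ _ =
    Above≥ y (x′ ∷ xs) ys
      ↔⟨ Above≥↔2×Below x′ xs ys (s≤s⁻¹ y≤x′) asc-xs asc-ys ⟩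
    (Fin 2 × Below (x′ ∷ xs) ys)
      ↔⟨ ↔-sym (BelowEntry-free x<y (s≤s⁻¹ y≤x′)) ×-↔ ↔-refl ⟩
    (Σ ℕ (BelowEntry x y x′) × Below (x′ ∷ xs) ys)
      ↔⟨ ↔-sym Below-∷ ⟩
    Below (x ∷ x′ ∷ xs) (y ∷ ys) ∎
  ... | tri≈ _ refl _ =
    Above≥ y (x′ ∷ xs) ys
      ↔⟨ Above≥↔Below x′ xs ys asc-xs asc-ys ⟩
    Below (x′ ∷ xs) ys
      ↔⟨ ↔-sym (⊤-×) ⟩
    (⊤ × Below (x′ ∷ xs) ys)
      ↔⟨ ↔-sym (BelowEntry-lowered x≤x′ refl) ×-↔ ↔-refl ⟩
    (Σ ℕ (BelowEntry x y x′) × Below (x′ ∷ xs) ys)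
      ↔⟨ ↔-sym Below-∷ ⟩
    Below (x ∷ x′ ∷ xs) (y ∷ ys) ∎
  ... | tri> _ _ 1+x′<y =
    empty↔ (Above≥-empty xs ys) (Below-∷-empty (inj₂ 1+x′<y))
    where
    Above≥-empty : ∀ {k} (xs ys : Vec ℕ k) → ¬ Above≥ y (x′ ∷ xs) ys
    Above≥-empty _ _ (_ ∷ _ , y≤z , ((_ , z≤1+x′) , _) , _) = <⇒≱ 1+x′<y (≤-trans y≤z z≤1+x′)

Above↔2×Below : ∀ x (xs ys : Vec ℕ k) → Ascending 0 (x ∷ xs) → Ascending 0 ys →
                Above (x ∷ xs) ys ↔ (Fin 2 × Below (x ∷ xs) ys)
Above↔2×Below x xs ys (_ , asc-xs) asc-ys =
  Above (x ∷ xs) ys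
    ↔⟨ mk↔ₛ′ (λ (zs , p) → zs , z≤n , p) (λ (zs , _ , p) → zs , p)
             (λ { (_ , z≤n , _) → refl }) (λ _ → refl) ⟩
  Above≥ 0 (x ∷ xs) ys
    ↔⟨ Above≥↔2×Below x xs ys z≤n asc-xs asc-ys ⟩
  (Fin 2 × Below (x ∷ xs) ys) ∎

-- Gelfand-Tsetlin patterns and their number.

GT : ∀ k → Vec ℕ k → Set
GT zero    _  = ⊤
GT (suc k) xs = Σ[ ys ∈ Vec ℕ k ] (ys ≺ xs × GT k ys)

GT⇒ascending : ∀ (xs : Vec ℕ k) → GT k xs → Ascending 0 xs
GT⇒ascending []       _            = tt
GT⇒ascending (x ∷ xs) (_ , ys≺xs , _) = ≺⇒ascendingʳ z≤n ys≺xs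

-- The dual Pieri rule for Schur functions, evaluated at x₁ = ⋯ = xₖ = 1.

pieri : ∀ (xs : Vec ℕ k) → Ascending 0 xs →
        (Σ[ zs ∈ Vec ℕ k ] (xs ↗ zs × GT k zs)) ↔ (Fin (2 ^ k) × GT k xs)
pieri {zero}  [] _ = mk↔ₛ′ (λ _ → zero , tt) (λ _ → [] , tt , tt)
                       (λ { (zero , tt) → refl }) (λ { ([] , _) → refl })
pieri {suc k} xs@(x ∷ xs′) asc =
  (Σ[ zs ∈ Vec ℕ (suc k) ] (xs ↗ zs × Σ[ ys ∈ Vec ℕ k ] (ys ≺ zs × GT k ys)))
    ↔⟨ mk↔ₛ′ (λ (zs , p , ys , q , g) → ys , g , zs , p , q)
             (λ (ys , g , zs , p , q) → zs , p , ys , q , g) (λ _ → refl) (λ _ → refl) ⟩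
  (Σ[ ys ∈ Vec ℕ k ] Σ[ _ ∈ GT k ys ] Above xs ys)
    -- The strip moves down one row: `xs` is no longer raised, `ys` becomes a raised `ws` with
    -- `ws ≺ xs`, and one bit splits off. The induction hypothesis then pushes the strip through the
    -- rows below `ws`.
    ↔⟨ Σ-cong (λ ys → Σ-cong (λ g → Above↔2×Below x xs′ ys asc (GT⇒ascending ys g))) ⟩
  (Σ[ ys ∈ Vec ℕ k ] Σ[ _ ∈ GT k ys ] (Fin 2 × Below xs ys))
    ↔⟨ mk↔ₛ′ (λ (ys , g , b , ws , p , q) → b , ws , q , ys , p , g)
             (λ (b , ws , q , ys , p , g) → ys , g , b , ws , p , q) (λ _ → refl) (λ _ → refl) ⟩
  (Fin 2 × Σ[ ws ∈ Vec ℕ k ] Σ[ _ ∈ ws ≺ xs ] Σ[ ys ∈ Vec ℕ k ] (ws ↗ ys × GT k ys))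
    ↔⟨ ↔-refl ×-↔ Σ-cong (λ ws → Σ-cong (λ p → pieri ws (≺⇒ascendingˡ z≤n p))) ⟩
  (Fin 2 × Σ[ ws ∈ Vec ℕ k ] (ws ≺ xs × Fin (2 ^ k) × GT k ws))
    ↔⟨ mk↔ₛ′ (λ (b , ws , p , c , g) → (b , c) , ws , p , g)
             (λ ((b , c) , ws , p , g) → b , ws , p , c , g) (λ _ → refl) (λ _ → refl) ⟩
  ((Fin 2 × Fin (2 ^ k)) × GT (suc k) xs)
    ↔⟨ ↔-sym *↔× ×-↔ ↔-refl ⟩
  (Fin (2 ^ suc k) × GT (suc k) xs) ∎

row : ∀ k → (ℕ → ℕ) → Vec ℕ k
row zero    f = []
row (suc k) f = f 0 ∷ row k (f ∘ suc)

Consecutive : (ℕ → ℕ) → Set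
Consecutive f = ∀ a → f (suc a) ≡ suc (f a)

consecutive⇒ascending : ∀ {f} k → Consecutive f → l ≤ f 0 → Ascending l (row k f)
consecutive⇒ascending zero    step l≤f0 = tt
consecutive⇒ascending (suc k) step l≤f0 =
  l≤f0 , consecutive⇒ascending k (step ∘ suc) (≤-trans (n≤1+n _) (≤-reflexive (sym (step 0))))

-- Since `f` grows by exactly one, the interlacing interval of each entry holds just two values:
-- stay or rise by one.
≺-consecutive : ∀ {f} → Consecutive f → (ys : Vec ℕ k) → (ys ≺ row (suc k) f) ↔ (row k f ↗ ys)
≺-consecutive step []       = ↔-refl
≺-consecutive step (y ∷ ys) =
  ↔-trans (↔-refl ×-↔ ≡⇒ (cong (y ≤_) (step 0)) ×-↔ ≺-consecutive (step ∘ suc) ys)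
          (↔-sym (×-assoc 0ℓ _ _ _))

[1+n]C2≡n+nC2 : ∀ n → suc n C 2 ≡ n + n C 2
[1+n]C2≡n+nC2 n = trans (sym (nCk+nC[k+1]≡[n+1]C[k+1] n 1)) (cong (_+ n C 2) (nC1≡n n))

GT-staircase : ∀ m → GT m (row m suc) ↔ Fin (2 ^ (m C 2))
GT-staircase zero    = ↔-sym 1↔⊤
GT-staircase (suc m) =
  (Σ[ ys ∈ Vec ℕ m ] (ys ≺ row (suc m) suc × GT m ys))
    ↔⟨ Σ-cong (λ ys → ≺-consecutive (λ _ → refl) ys ×-↔ ↔-refl) ⟩
  (Σ[ ys ∈ Vec ℕ m ] (row m suc ↗ ys × GT m ys))
    ↔⟨ pieri (row m suc) (consecutive⇒ascending m (λ _ → refl) z≤n) ⟩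
  (Fin (2 ^ m) × GT m (row m suc))
    ↔⟨ ↔-refl ×-↔ GT-staircase m ⟩
  (Fin (2 ^ m) × Fin (2 ^ (m C 2)))
    ↔⟨ ↔-sym *↔× ⟩
  Fin (2 ^ m * 2 ^ (m C 2))
    ≡⟨ cong Fin (sym (trans (cong (2 ^_) ([1+n]C2≡n+nC2 m)) (^-distribˡ-+-* 2 m (m C 2)))) ⟩
  Fin (2 ^ (suc m C 2)) ∎

-- Patterns as triangular arrays.

at : Vec ℕ k → ℕ → ℕ
at []       _       = 0
at (x ∷ xs) zero    = x
at (x ∷ xs) (suc a) = at xs a

at-row : ∀ k f {a} → a < k → at (row k f) a ≡ f a
at-row (suc k) f {zero}  _         = refl
at-row (suc k) f {suc a} (s≤s a<k) = at-row k (f ∘ suc) a<k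

at-ext : ∀ (xs ys : Vec ℕ k) → (∀ {a} → a < k → at xs a ≡ at ys a) → xs ≡ ys
at-ext []       []       _  = refl
at-ext (x ∷ xs) (y ∷ ys) eq = cong₂ _∷_ (eq z<s) (at-ext xs ys (eq ∘ s<s))

≺⇒at≤at : ∀ (ys : Vec ℕ k) xs → ys ≺ xs → ∀ {a} → a < k →
          at xs a ≤ at ys a × at ys a ≤ at xs (suc a)
≺⇒at≤at (y ∷ ys) (x ∷ x′ ∷ xs) (x≤y , y≤x′ , _)  {zero}  _         = x≤y , y≤x′
≺⇒at≤at (y ∷ ys) (x ∷ xs)      (_ , _ , ys≺xs) {suc a} (s≤s a<k) = ≺⇒at≤at ys xs ys≺xs a<k

row-≺ : ∀ k f g → (∀ {a} → a < k → f a ≤ g a × g a ≤ f (suc a)) → row k g ≺ row (suc k) f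
row-≺ zero    f g _  = tt
row-≺ (suc k) f g le = proj₁ (le z<s) , proj₂ (le z<s) , row-≺ k (f ∘ suc) (g ∘ suc) (le ∘ s<s)

-- `T d a` is entry `a` of the `d`th row below the top, a row of length `k ∸ d`. The bound keeps all
-- three compared entries inside the triangle.
Interlaced : ℕ → (ℕ → ℕ → ℕ) → Set
Interlaced k T = ∀ d a → d + suc a < k → T d a ≤ T (suc d) a × T (suc d) a ≤ T d (suc a)

fromArray : ∀ k T → Interlaced k T → GT k (row k (T 0))
fromArray zero    T _   = tt
fromArray (suc k) T int =
  row k (T 1) , row-≺ k (T 0) (T 1) (int 0 _ ∘ s<s) ,
  fromArray k (T ∘ suc) (λ d a → int (suc d) a ∘ s<s)

entry : ∀ k xs → GT k xs → ℕ → ℕ → ℕ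
entry k       xs _            zero    a = at xs a
entry zero    _  _            (suc d) a = 0
entry (suc k) _  (ys , _ , g) (suc d) a = entry k ys g d a

entry-fromArray : ∀ k T int d a → d + a < k → entry k _ (fromArray k T int) d a ≡ T d a
entry-fromArray k       T int zero    a a<k         = at-row k (T 0) a<k
entry-fromArray (suc k) T int (suc d) a (s≤s d+a<k) = entry-fromArray k (T ∘ suc) _ d a d+a<k

entry-interlaced : ∀ k xs g → Interlaced k (entry k xs g)
entry-interlaced (suc k) xs (ys , ys≺xs , g) zero    a (s≤s a<k) = ≺⇒at≤at ys xs ys≺xs a<k
entry-interlaced (suc k) xs (ys , ys≺xs , g) (suc d) a (s≤s lt)  = entry-interlaced k ys g d a lt

entry-ext : ∀ k xs (g h : GT k xs) →
            (∀ d a → d + a < k → entry k xs g d a ≡ entry k xs h d a) → g ≡ h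
entry-ext zero    _  _ _ _ = refl
entry-ext (suc k) xs (ys , p , g) (zs , q , h) eq
  -- Row 0 is `xs` in both patterns, so the comparison starts with row 1.
  with refl ← at-ext ys zs (λ {a} a<k → eq 1 a (s<s a<k)) =
  cong₂ (λ p g → ys , p , g) (≺-irrelevant ys xs p q)
        (entry-ext k ys g h (λ d a lt → eq (suc d) a (s<s lt)))

module _ {k : ℕ} {T : ℕ → ℕ → ℕ} (int : Interlaced k T) where

  interlaced-≤ˡ : ∀ {d d′ a} → d ≤′ d′ → d′ + a < k → T d a ≤ T d′ a
  interlaced-≤ˡ (≤′-reflexive refl) _ = ≤-refl
  interlaced-≤ˡ {a = a} (≤′-step {d′} d≤d′) lt = ≤-trans
    (interlaced-≤ˡ d≤d′ (<⇒≤ lt))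
    (proj₁ (int d′ a (subst (_< k) (sym (+-suc d′ a)) lt)))

  -- Iterates the second inequality, along which row plus position is constant. The pair of
  -- alternatives `a < c` sits in row `c ∸ suc a`, so fixing `c` fixes that sum.
  interlaced-≤ʳ : ∀ {a b c} → a ≤′ b → b < c → c ≤ k → T (c ∸ suc a) a ≤ T (c ∸ suc b) b
  interlaced-≤ʳ (≤′-reflexive refl) _ _ = ≤-refl
  interlaced-≤ʳ {c = c} (≤′-step {b} a≤b) b<c c≤k = ≤-trans
    (interlaced-≤ʳ a≤b (<⇒≤ b<c) c≤k)
    (subst (λ d → T d b ≤ T (c ∸ suc (suc b)) (suc b)) (sym (+-∸-assoc 1 b<c))
      (proj₂ (int _ b (<-≤-trans (≤-reflexive lemma) c≤k))))
    where
    lemma : suc (c ∸ suc (suc b) + suc b) ≡ c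
    lemma = trans (sym (+-suc _ (suc b))) (m∸n+n≡m b<c)

-- Initial segments of voters and their lengths.

threshold : Decidable {A = Fin n} P → ℕ
threshold {zero}  P? = 0
threshold {suc n} P? with P? zero
... | yes _ = suc (threshold (P? ∘ suc))
... | no  _ = 0

threshold≤n : (P? : Decidable {A = Fin n} P) → threshold P? ≤ n
threshold≤n {zero}  P? = z≤n
threshold≤n {suc n} P? with P? zero
... | yes _ = s≤s (threshold≤n (P? ∘ suc))
... | no  _ = z≤n

<threshold⇒ : (P? : Decidable {A = Fin n} P) → ∀ i → toℕ i < threshold P? → P i
<threshold⇒ P? zero lt with P? zero
... | yes p₀ = p₀
<threshold⇒ P? (suc i) lt with P? zero
<threshold⇒ P? (suc i) (s≤s lt) | yes _ = <threshold⇒ (P? ∘ suc) i lt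

⇒<threshold : (P? : Decidable {A = Fin n} P) → (∀ {i j} → i Fin.< j → P j → P i) →
              ∀ i → P i → toℕ i < threshold P?
⇒<threshold P? closed zero p₀ with P? zero
... | yes _  = z<s
... | no ¬p₀ = ⊥-elim (¬p₀ p₀)
⇒<threshold P? closed (suc i) pi with P? zero
... | yes _  = s<s (⇒<threshold (P? ∘ suc) (closed ∘ s<s) i pi)
... | no ¬p₀ = ⊥-elim (¬p₀ (closed z<s pi))

-- If `t < s ≤ n`, then `t` is itself an element of `Fin n`, and the hypothesis at that element
-- reads `t < t`.
<-determines-≤ : ∀ {s t} → s ≤ n → (∀ (i : Fin n) → toℕ i < s → toℕ i < t) → s ≤ t
<-determines-≤ {s = s} {t} s≤n ⇒ with s ≤? t
... | yes s≤t = s≤t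
... | no  s≰t = ⊥-elim (<-irrefl (toℕ-fromℕ< t<n)
  (⇒ (Fin.fromℕ< t<n) (subst (_< s) (sym (toℕ-fromℕ< t<n)) (≰⇒> s≰t))))
  where t<n = <-≤-trans (≰⇒> s≰t) s≤n

threshold-cong : (P? : Decidable {A = Fin n} P) (Q? : Decidable Q) →
                 (∀ {i} → P i ⇔ Q i) → threshold P? ≡ threshold Q?
threshold-cong {n = zero}  P? Q? P⇔Q = refl
threshold-cong {n = suc n} P? Q? P⇔Q with P? zero | Q? zero
... | yes _ | yes _ = cong suc (threshold-cong (P? ∘ suc) (Q? ∘ suc) P⇔Q)
... | no  _ | no  _ = refl
... | yes p | no ¬q = ⊥-elim (¬q (Equivalence.to P⇔Q p))
... | no ¬p | yes q = ⊥-elim (¬p (Equivalence.from P⇔Q q))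

-- For a < b, the voters preferring a to b are to be those i with toℕ i < t a b; the
-- remaining values of t are irrelevant.

record Thresholds (n : ℕ) : Set where
  field
    t      : Fin n → Fin n → ℕ
    lower  : ∀ {a b} → a Fin.< b → toℕ a < t a b
    upper  : ∀ {a b} → a Fin.< b → t a b ≤ toℕ b
    monoʳ  : ∀ {a b c} → a Fin.< b → b Fin.≤ c → t a b ≤ t a c
    monoˡ  : ∀ {a b c} → a Fin.≤ b → b Fin.< c → t a c ≤ t b c

-- From thresholds to profiles.

module FromThresholds {n : ℕ} (Th : Thresholds n) where
  open Thresholds Th

  infix 4 _≻⟨_⟩_
  _≻⟨_⟩_ : Fin n → Fin n → Fin n → Set
  a ≻⟨ i ⟩ b = (a Fin.< b × toℕ i < t a b) ⊎ (b Fin.< a × t b a ≤ toℕ i)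

  -- When the two preferences run in opposite directions, the order of `a` and `c` is not given;
  -- monotonicity of `t` rules out the wrong one. In each case it then carries one of the two bounds
  -- over to the pair of `a` and `c`.
  ≻-trans : ∀ i {a b c} → a ≻⟨ i ⟩ b → b ≻⟨ i ⟩ c → a ≻⟨ i ⟩ c
  ≻-trans i {a} {b} {c} (inj₁ (a<b , i<ab)) (inj₁ (b<c , i<bc)) =
    inj₁ (<-trans a<b b<c , <-≤-trans i<ab (monoʳ a<b (<⇒≤ b<c)))
  ≻-trans i {a} {b} {c} (inj₁ (a<b , i<ab)) (inj₂ (c<b , cb≤i)) =
    inj₂ (c<a , ≤-trans (monoʳ c<a (<⇒≤ a<b)) cb≤i)
    where
    c<a : c Fin.< a
    c<a = ≰⇒> λ a≤c → <⇒≱ i<ab (≤-trans (monoˡ a≤c c<b) cb≤i)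
  ≻-trans i {a} {b} {c} (inj₂ (b<a , ba≤i)) (inj₁ (b<c , i<bc)) =
    inj₁ (a<c , <-≤-trans i<bc (monoˡ (<⇒≤ b<a) a<c))
    where
    a<c : a Fin.< c
    a<c = ≰⇒> λ c≤a → <⇒≱ i<bc (≤-trans (monoʳ b<c c≤a) ba≤i)
  ≻-trans i {a} {b} {c} (inj₂ (b<a , ba≤i)) (inj₂ (c<b , cb≤i)) =
    inj₂ (<-trans c<b b<a , ≤-trans (monoˡ (<⇒≤ c<b) b<a) ba≤i)

  ≻-irrefl : ∀ i {a} → ¬ a ≻⟨ i ⟩ a
  ≻-irrefl i (inj₁ (a<a , _)) = <-irrefl refl a<a
  ≻-irrefl i (inj₂ (a<a , _)) = <-irrefl refl a<a

  ≻-compare : ∀ i → Trichotomous _≡_ (λ a b → a ≻⟨ i ⟩ b)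
  ≻-compare i a b with Fin.<-cmp a b
  ... | tri≈ _ refl _ = tri≈ (≻-irrefl i) refl (≻-irrefl i)
  ... | tri< a<b a≢b _ with toℕ i <? t a b
  ...   | yes i<t = tri< a≻b a≢b (λ b≻a → ≻-irrefl i (≻-trans i a≻b b≻a))
    where a≻b = inj₁ (a<b , i<t)
  ...   | no  i≮t = tri> (λ a≻b → ≻-irrefl i (≻-trans i a≻b b≻a)) a≢b b≻a
    where b≻a = inj₂ (a<b , ≮⇒≥ i≮t)
  ≻-compare i a b | tri> _ a≢b b<a with toℕ i <? t b a
  ...   | yes i<t = tri> (λ a≻b → ≻-irrefl i (≻-trans i a≻b b≻a)) a≢b b≻a
    where b≻a = inj₁ (b<a , i<t)
  ...   | no  i≮t = tri< a≻b a≢b (λ b≻a → ≻-irrefl i (≻-trans i a≻b b≻a))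
    where a≻b = inj₂ (b<a , ≮⇒≥ i≮t)

  profile : Profile n
  profile i = record
    { _≻_                = λ a b → a ≻⟨ i ⟩ b
    ; isStrictTotalOrder = isStrictTotalOrderᶜ record
      { isEquivalence = isEquivalence
      ; trans         = ≻-trans i
      ; compare       = ≻-compare i
      }
    }

  narcissistic : Narcissistic profile
  narcissistic i a a≢i with Fin.<-cmp i a
  ... | tri< i<a _ _ = inj₁ (i<a , lower i<a)
  ... | tri≈ _ i≡a _ = ⊥-elim (a≢i (sym i≡a))
  ... | tri> _ _ a<i = inj₂ (a<i , upper a<i)

  singleCrossing : SingleCrossing (naturalOrder n) profile
  singleCrossing a b _ i j k i<j j<k (inj₁ _) (inj₁ (a<b , k<t)) = inj₁ (a<b , <-trans j<k k<t)
  singleCrossing a b _ i j k i<j j<k (inj₂ (b<a , t≤i)) (inj₂ _) =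
    inj₂ (b<a , ≤-trans t≤i (<⇒≤ i<j))
  singleCrossing a b _ i j k i<j j<k (inj₁ (a<b , _)) (inj₂ (b<a , _)) = ⊥-elim (<-asym a<b b<a)
  singleCrossing a b _ i j k i<j j<k (inj₂ (b<a , _)) (inj₁ (a<b , _)) = ⊥-elim (<-asym a<b b<a)

  ≻⇒< : ∀ {i a b} → a Fin.< b → a ≻⟨ i ⟩ b → toℕ i < t a b
  ≻⇒< a<b (inj₁ (_ , i<t)) = i<t
  ≻⇒< a<b (inj₂ (b<a , _)) = ⊥-elim (<-asym a<b b<a)

-- From profiles to thresholds.

module ToThresholds {n : ℕ} (P : Profile n) (narc : Narcissistic P)
                    (sc : SingleCrossing (naturalOrder n) P) where

  private
    module O i = IsStrictTotalOrder (StrictLinearOrder.isStrictTotalOrder (P i))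

  ≻-flip : ∀ {i a b} → a ≢ b → ¬ a ≻[ P , i ] b → b ≻[ P , i ] a
  ≻-flip {i} {a} {b} a≢b a⊁b with O.compare i a b
  ... | tri< a≻b _ _ = ⊥-elim (a⊁b a≻b)
  ... | tri≈ _ a≡b _ = ⊥-elim (a≢b a≡b)
  ... | tri> _ _ b≻a = b≻a

  Fin-<⇒≢ : ∀ {a b : Fin n} → a Fin.< b → a ≢ b
  Fin-<⇒≢ a<b refl = <-irrefl refl a<b

  -- For `a < i`, voter `i` stands between `j` and voter `a`, who both prefer `a`. For `i < a`, if
  -- `i` preferred `b`, then so would voter `a`, standing between `i` and voter `b`; this
  -- contradicts narcissism.
  ≻-downClosed : ∀ {a b} → a Fin.< b → ∀ {i j} → i Fin.< j → a ≻[ P , j ] b → a ≻[ P , i ] b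
  ≻-downClosed {a} {b} a<b {i} {j} i<j a≻ⱼb with Fin.<-cmp a i
  ... | tri< a<i _ _ = sc a b (Fin-<⇒≢ a<b) a i j a<i i<j (narc a b (≢-sym (Fin-<⇒≢ a<b))) a≻ⱼb
  ... | tri≈ _ refl _ = narc a b (≢-sym (Fin-<⇒≢ a<b))
  ... | tri> _ _ i<a with O._<?_ i a b
  ...   | yes a≻ᵢb = a≻ᵢb
  ...   | no  a⊁ᵢb = ⊥-elim (O.irrefl a refl (O.trans a (narc a b b≢a) b≻ₐa))
    where
    b≢a : b ≢ a
    b≢a = ≢-sym (Fin-<⇒≢ a<b)
    b≻ₐa : b ≻[ P , a ] a
    b≻ₐa = sc b a b≢a i a b i<a a<b (≻-flip (≢-sym b≢a) a⊁ᵢb) (narc b a (≢-sym b≢a))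

  prefers? : ∀ a b → Decidable (λ i → a ≻[ P , i ] b)
  prefers? a b i = O._<?_ i a b

  t : Fin n → Fin n → ℕ
  t a b = threshold (prefers? a b)

  <t⇒≻ : ∀ {i a b} → toℕ i < t a b → a ≻[ P , i ] b
  <t⇒≻ {i} {a} {b} = <threshold⇒ (prefers? a b) i

  ≻⇒<t : ∀ {i a b} → a Fin.< b → a ≻[ P , i ] b → toℕ i < t a b
  ≻⇒<t {i} {a} {b} a<b = ⇒<threshold (prefers? a b) (≻-downClosed a<b) i

  t-lower : ∀ {a b} → a Fin.< b → toℕ a < t a b
  t-lower {a} {b} a<b = ≻⇒<t a<b (narc a b (≢-sym (Fin-<⇒≢ a<b)))

  t-upper : ∀ {a b} → a Fin.< b → t a b ≤ toℕ b
  t-upper {a} {b} a<b = ≮⇒≥ λ b<t → O.irrefl b refl (O.trans b (narc b a (Fin-<⇒≢ a<b)) (<t⇒≻ b<t))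

  -- Together with `≻-ascending`: each voter's order is single-peaked along the natural order, with
  -- the voter at the peak. This is what turns transitivity into monotonicity of `t`.
  ≻-descending : ∀ {i a b} → a Fin.< b → b Fin.≤ i → b ≻[ P , i ] a
  ≻-descending {i} a<b b≤i = ≻-flip (Fin-<⇒≢ a<b) λ a≻b →
    <⇒≱ (≻⇒<t a<b a≻b) (≤-trans (t-upper a<b) b≤i)

  ≻-ascending : ∀ {i a b} → i Fin.≤ a → a Fin.< b → a ≻[ P , i ] b
  ≻-ascending i≤a a<b = <t⇒≻ (≤-<-trans i≤a (t-lower a<b))

  -- A voter counted by `t a b` stands before `b`, hence prefers `b` to any later `c`, and
  -- transitivity through `b` applies.
  t-monoʳ : ∀ {a b c} → a Fin.< b → b Fin.≤ c → t a b ≤ t a c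
  t-monoʳ {a} {b} {c} a<b b≤c = <-determines-≤ (threshold≤n (prefers? a b)) λ i i<t →
    ≻⇒<t (<-≤-trans a<b b≤c) (via i i<t)
    where
    via : ∀ i → toℕ i < t a b → a ≻[ P , i ] c
    via i i<t with Fin.<-cmp b c
    ... | tri< b<c _ _ = O.trans i (<t⇒≻ i<t) (≻-ascending (<⇒≤ (<-≤-trans i<t (t-upper a<b))) b<c)
    ... | tri≈ _ refl _ = <t⇒≻ i<t
    ... | tri> _ _ c<b = ⊥-elim (<⇒≱ c<b b≤c)

  -- A voter from `b` on prefers `b` to `a`, and so to `c` by transitivity; a voter up to `b`
  -- prefers `b` to `c` outright.
  t-monoˡ : ∀ {a b c} → a Fin.≤ b → b Fin.< c → t a c ≤ t b c
  t-monoˡ {a} {b} {c} a≤b b<c = <-determines-≤ (threshold≤n (prefers? a c)) λ i i<t →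
    ≻⇒<t b<c (via i (<t⇒≻ i<t))
    where
    via : ∀ i → a ≻[ P , i ] c → b ≻[ P , i ] c
    via i a≻c with Fin.<-cmp a b | ≤-total (toℕ b) (toℕ i)
    ... | tri≈ _ refl _ | _        = a≻c
    ... | tri> _ _ b<a  | _        = ⊥-elim (<⇒≱ b<a a≤b)
    ... | tri< a<b _ _  | inj₁ b≤i = O.trans i (≻-descending a<b b≤i) a≻c
    ... | tri< _ _ _    | inj₂ i≤b = ≻-ascending i≤b b<c

  thresholds : Thresholds n
  thresholds = record
    { t = t ; lower = t-lower ; upper = t-upper ; monoʳ = t-monoʳ ; monoˡ = t-monoˡ }

  private
    module F = FromThresholds thresholds

  profile-thresholds : Setoid._≈_ (profileSetoid n) F.profile P
  profile-thresholds i = to , from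
    where
    to : ∀ {a b} → a F.≻⟨ i ⟩ b → a ≻[ P , i ] b
    to (inj₁ (_ , i<t))   = <t⇒≻ i<t
    to (inj₂ (b<a , t≤i)) = ≻-flip (Fin-<⇒≢ b<a) λ b≻a → <⇒≱ (≻⇒<t b<a b≻a) t≤i
    from : ∀ {a b} → a ≻[ P , i ] b → a F.≻⟨ i ⟩ b
    from {a} {b} a≻b with Fin.<-cmp a b
    ... | tri< a<b _ _ = inj₁ (a<b , ≻⇒<t a<b a≻b)
    ... | tri≈ _ refl _ = ⊥-elim (O.irrefl i refl a≻b)
    ... | tri> _ _ b<a = inj₂ (b<a , ≮⇒≥ λ i<t → O.irrefl i refl (O.trans i a≻b (<t⇒≻ i<t)))

-- Thresholds and triangular arrays.

toℕ-mod : ∀ {m a} → a < suc m → toℕ (a mod suc m) ≡ a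
toℕ-mod a<n = trans (toℕ-fromℕ< _) (m<n⇒m%n≡m a<n)

mod-toℕ : ∀ {m} (i : Fin (suc m)) → toℕ i mod suc m ≡ i
mod-toℕ i = toℕ-injective (toℕ-mod (toℕ<n i))

module ToArray {m : ℕ} (Th : Thresholds (suc m)) where
  open Thresholds Th

  -- Row `d` collects the pairs of alternatives at distance `d + 1`. `mod` serves as a total map
  -- from `ℕ` to `Fin (suc m)`, exact for arguments up to `m`.
  diagonal : ℕ → ℕ → ℕ
  diagonal d a = t (a mod suc m) (suc (d + a) mod suc m)

  -- The zeroth row must be row m suc definitionally; it agrees with diagonal 0 on a < m.

  array : ℕ → ℕ → ℕ
  array zero    a = suc a
  array (suc d) a = diagonal (suc d) a

  mod-< : ∀ {a b} → a < b → b ≤ m → a mod suc m Fin.< b mod suc m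
  mod-< a<b b≤m = subst₂ _<_
    (sym (toℕ-mod (s≤s (<⇒≤ (<-≤-trans a<b b≤m))))) (sym (toℕ-mod (s≤s b≤m))) a<b

  mod-≤ : ∀ {a b} → a ≤ b → b ≤ m → a mod suc m Fin.≤ b mod suc m
  mod-≤ a≤b b≤m = subst₂ _≤_
    (sym (toℕ-mod (s≤s (≤-trans a≤b b≤m)))) (sym (toℕ-mod (s≤s b≤m))) a≤b

  -- For the neighbours `a` and `a + 1`, `lower` and `upper` leave `a + 1` as the only possible
  -- threshold.
  array≡diagonal : ∀ d a → d + a < m → array d a ≡ diagonal d a
  array≡diagonal (suc d) a _   = refl
  array≡diagonal zero    a a<m = ≤-antisym
    (subst (_< diagonal 0 a) (toℕ-mod (m≤n⇒m≤1+n a<m)) (lower a<1+a))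
    (subst (diagonal 0 a ≤_) (toℕ-mod (s≤s a<m)) (upper a<1+a))
    where a<1+a = mod-< (n<1+n a) a<m

  -- Position `a` of row `d + 1` belongs to the pair `(a , d + a + 2)`, between `(a , d + a + 1)`
  -- and `(a + 1 , d + a + 2)` in row `d`. The two inequalities are therefore `monoʳ` and `monoˡ`.
  array-interlaced : Interlaced m array
  array-interlaced d a lt =
    subst (_≤ diagonal (suc d) a) (sym (array≡diagonal d a (<⇒≤ lt′)))
      (monoʳ (mod-< (s≤s (m≤n+m a d)) (<⇒≤ lt′)) (mod-≤ (n≤1+n _) lt′)) ,
    subst (diagonal (suc d) a ≤_) (sym (array≡diagonal d (suc a) lt))
      (subst (λ c → diagonal (suc d) a ≤ t (suc a mod suc m) (suc c mod suc m)) (sym (+-suc d a))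
        (monoˡ (mod-≤ (n≤1+n a) (≤-trans (m≤n+m (suc a) d) (<⇒≤ lt)))
               (mod-< (s≤s (s≤s (m≤n+m a d))) lt′)))
    where
    lt′ : suc (d + a) < m
    lt′ = subst (_< m) (+-suc d a) lt

module FromArray {m : ℕ} {T : ℕ → ℕ → ℕ} (T₀ : ∀ {a} → a < m → T 0 a ≡ suc a)
                 (int : Interlaced m T) where

  t : Fin (suc m) → Fin (suc m) → ℕ
  t a b = T (toℕ b ∸ suc (toℕ a)) (toℕ a)

  private
    range : ∀ {a b} → a < b → b ≤ m → b ∸ suc a + a < m
    range {a} {b} a<b b≤m =
      <-≤-trans (≤-reflexive (trans (sym (+-suc _ a)) (m∸n+n≡m a<b))) b≤m

    ≤m : (b : Fin (suc m)) → toℕ b ≤ m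
    ≤m b = s≤s⁻¹ (toℕ<n b)

  -- Following the second inequality up to row 0 keeps `d + a` fixed, and there `T₀` gives the
  -- value. The field `lower` below starts instead from `T 0 a ≡ suc a` and follows the first
  -- inequality down.
  T-upper : ∀ d a → d + a < m → T d a ≤ suc (d + a)
  T-upper zero    a lt = ≤-reflexive (T₀ lt)
  T-upper (suc d) a lt = ≤-trans (proj₂ (int d a lt′))
    (subst (λ s → T d (suc a) ≤ suc s) (+-suc d a) (T-upper d (suc a) lt′))
    where lt′ = subst (_< m) (sym (+-suc d a)) lt

  thresholds : Thresholds (suc m)
  thresholds = record
    { t     = t
    ; lower = λ {a} {b} a<b → subst (_≤ t a b) (T₀ (<-≤-trans a<b (≤m b)))
                (interlaced-≤ˡ int (≤⇒≤′ z≤n) (range a<b (≤m b)))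
    ; upper = λ {a} {b} a<b → subst (t a b ≤_) (trans (sym (+-suc _ (toℕ a))) (m∸n+n≡m a<b))
                (T-upper _ (toℕ a) (range a<b (≤m b)))
    ; monoʳ = λ {a} {b} {c} a<b b≤c →
                interlaced-≤ˡ int (≤⇒≤′ (∸-monoˡ-≤ (suc (toℕ a)) b≤c))
                              (range (<-≤-trans a<b b≤c) (≤m c))
    ; monoˡ = λ {a} {b} {c} a≤b b<c → interlaced-≤ʳ int (≤⇒≤′ a≤b) b<c (≤m c)
    }

-- The bijection between profiles and patterns.

threshold-< : ∀ {t} (P? : Decidable {A = Fin n} P) → t ≤ n →
              (∀ {i} → P i ⇔ toℕ i < t) → threshold P? ≡ t
threshold-< P? t≤n P⇔<t = ≤-antisym
  (<-determines-≤ (threshold≤n P?) λ i lt → Equivalence.to P⇔<t (<threshold⇒ P? i lt))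
  (<-determines-≤ t≤n λ i i<t → ⇒<threshold P?
    (λ i<j pj → Equivalence.from P⇔<t (<-trans i<j (Equivalence.to P⇔<t pj)))
    i (Equivalence.from P⇔<t i<t))

module _ (m : ℕ) where

  private
    S : Setoid _ _
    S = narcissisticSingleCrossingProfiles (suc m) (naturalOrder (suc m))
    open Setoid S using (_≈_) renaming (Carrier to Profiles)

  module Encode (𝒫 : Profiles) = ToThresholds (proj₁ 𝒫) (proj₁ (proj₂ 𝒫)) (proj₂ (proj₂ 𝒫))
  module Array (𝒫 : Profiles) = ToArray (Encode.thresholds 𝒫)

  encode : Profiles → GT m (row m suc)
  encode 𝒫 = fromArray m (Array.array 𝒫) (Array.array-interlaced 𝒫)

  module Decode (g : GT m (row m suc)) =
    FromArray (λ a<m → at-row m suc a<m) (entry-interlaced m _ g)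

  decode : GT m (row m suc) → Profiles
  decode g = profile , narcissistic , singleCrossing
    where open FromThresholds (Decode.thresholds g)

  array-cong : ∀ {𝒫 𝒬} → 𝒫 ≈ 𝒬 → ∀ d a → Array.array 𝒫 d a ≡ Array.array 𝒬 d a
  array-cong         eq zero    a = refl
  array-cong {𝒫} {𝒬} eq (suc d) a = threshold-cong (Encode.prefers? 𝒫 _ _) (Encode.prefers? 𝒬 _ _)
    (λ {i} → mk⇔ (proj₁ (eq i)) (proj₂ (eq i)))

  entry-encode : ∀ 𝒫 d a → d + a < m → entry m _ (encode 𝒫) d a ≡ Array.array 𝒫 d a
  entry-encode 𝒫 = entry-fromArray m (Array.array 𝒫) (Array.array-interlaced 𝒫)

  encode-cong : ∀ {𝒫 𝒬} → 𝒫 ≈ 𝒬 → encode 𝒫 ≡ encode 𝒬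
  encode-cong {𝒫} {𝒬} eq = entry-ext m _ _ _ λ d a lt →
    trans (entry-encode 𝒫 d a lt)
          (trans (array-cong {𝒫} {𝒬} eq d a) (sym (entry-encode 𝒬 d a lt)))

  encode-decode : ∀ g → encode (decode g) ≡ g
  encode-decode g = entry-ext m _ _ _ λ d a lt →
    trans (entry-encode (decode g) d a lt)
          (trans (Array.array≡diagonal (decode g) d a lt) (diagonal≡entry d a lt))
    where
    open Decode g using (thresholds; t)
    open FromThresholds thresholds using (≻⇒<)
    diagonal≡entry : ∀ d a → d + a < m → Array.diagonal (decode g) d a ≡ entry m _ g d a
    diagonal≡entry d a lt = trans
      -- The voters counted are those below the decoded `t`, so the count returns `t`; the row index
      -- `d` is recovered as the distance from `a′` to `b′` less one.
      (threshold-< (Encode.prefers? (decode g) a′ b′)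
        (≤-trans (Thresholds.upper thresholds a<b) (<⇒≤ (toℕ<n b′)))
        (mk⇔ (≻⇒< a<b) (λ i<t → inj₁ (a<b , i<t))))
      (cong₂ (entry m _ g)
        (trans (cong₂ (λ b a → b ∸ suc a) (toℕ-mod (s≤s lt)) a′≡a) (m+n∸n≡m d a))
        a′≡a)
      where
      a′ = a mod suc m
      b′ = suc (d + a) mod suc m
      a′≡a : toℕ a′ ≡ a
      a′≡a = toℕ-mod (s≤s (≤-trans (m≤n+m a d) (<⇒≤ lt)))
      a<b : a′ Fin.< b′
      a<b = Array.mod-< (decode g) (s≤s (m≤n+m a d)) lt

  -- Decoded and original thresholds are compared on pairs `a < b`, all that a profile built from
  -- thresholds consults. The link to `𝒫` is the profile rebuilt from its own thresholds.
  decode-encode : ∀ 𝒫 → decode (encode 𝒫) ≈ 𝒫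
  decode-encode 𝒫 = S.trans {decode (encode 𝒫)} {intermediate} {𝒫}
    same-thresholds (Encode.profile-thresholds 𝒫)
    where
    module S = Setoid S
    open Encode 𝒫 using (thresholds)
    module E = FromThresholds thresholds
    open Decode (encode 𝒫) using () renaming (t to t′)
    intermediate : Profiles
    intermediate = E.profile , E.narcissistic , E.singleCrossing

    t′≡t : ∀ {a b} → a Fin.< b → t′ a b ≡ Encode.t 𝒫 a b
    t′≡t {a} {b} a<b =
      trans (entry-encode 𝒫 (toℕ b ∸ suc (toℕ a)) (toℕ a) lt)
            (trans (Array.array≡diagonal 𝒫 (toℕ b ∸ suc (toℕ a)) (toℕ a) lt)
                   (cong₂ (Encode.t 𝒫) (mod-toℕ a) (trans (cong (_mod suc m) b≡) (mod-toℕ b))))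
      where
      b≡ : suc (toℕ b ∸ suc (toℕ a) + toℕ a) ≡ toℕ b
      b≡ = trans (sym (+-suc _ (toℕ a))) (m∸n+n≡m a<b)
      lt : toℕ b ∸ suc (toℕ a) + toℕ a < m
      lt = <-≤-trans (≤-reflexive b≡) (s≤s⁻¹ (toℕ<n b))

    same-thresholds : decode (encode 𝒫) ≈ intermediate
    same-thresholds i =
      (λ { {a} {b} (inj₁ (a<b , i<t)) → inj₁ (a<b , subst (toℕ i <_) (t′≡t a<b) i<t)
         ; {a} {b} (inj₂ (b<a , t≤i)) → inj₂ (b<a , subst (_≤ toℕ i) (t′≡t b<a) t≤i) }) ,
      (λ { {a} {b} (inj₁ (a<b , i<t)) → inj₁ (a<b , subst (toℕ i <_) (sym (t′≡t a<b)) i<t)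
         ; {a} {b} (inj₂ (b<a , t≤i)) → inj₂ (b<a , subst (_≤ toℕ i) (sym (t′≡t b<a)) t≤i) })

  profiles↔GT : Inverse S (setoid (GT m (row m suc)))
  profiles↔GT = record
    { to        = encode
    ; from      = decode
    ; to-cong   = λ {𝒫} {𝒬} → encode-cong {𝒫} {𝒬}
    ; from-cong = λ { {g} refl → Setoid.refl S {decode g} }
    ; inverse   = (λ {g} {𝒫} eq → trans (encode-cong {𝒫} {decode g} eq) (encode-decode g))
                , (λ { {𝒫} refl → decode-encode 𝒫 })
    }

theorem3 : (n : ℕ) → n ≥ 2 →
    HasCardinality (narcissisticSingleCrossingProfiles n (naturalOrder n)) (2 ^ ((n ∸ 1) C 2))
theorem3 (suc m) _ = Composition.inverse (profiles↔GT m) (GT-staircase m)
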